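{- Let $\mathcal{P}(\mathbb{N})$ be Scott's graph model and $C(A)=\mathbb{N}-A$ the complement function on it. The Cantor topology on $\mathcal{P}(\mathbb{N})$ is a conrep topology for the pca $\mathcal{P}(\mathbb{N})[C]$.
   Context: A partial combinatory algebra (pca) is a set $\mathcal{A}$ with a partial binary application $(a,b)\mapsto ab$ (associating to the left) such that there are $\mathsf{k},\mathsf{s}\in\mathcal{A}$ with, for all $a,b,c$: $\mathsf{k}ab=a$; $\mathsf{s}ab$ is defined; and whenever $(ac)(bc)$ is defined, $\mathsf{s}abc$ is defined and equals $(ac)(bc)$. A partial function $f:\mathcal{A}\to\mathcal{A}$ is representable in $\mathcal{A}$ if there is $a_f\in\mathcal{A}$ with $a_fa=f(a)$ for all $a$ in the domain of $f$. A topology on a pca $\mathcal{A}$ is conrep if every partial function $\mathcal{A}\to\mathcal{A}$ that is continuous on its domain (as subspace) is representable in $\mathcal{A}$. Every pca contains booleans $\mathsf{T},\mathsf{F}$ with a definition-by-cases element $D$ ($D\mathsf{T}ab=a$, $D\mathsf{F}ab=b$), and standard codings $[a,b]$ of pairs and $[a_0,\ldots,a_{n-1}]$ of finite sequences whose basic operations (length, projections, appending) are representable; fix such choices. For a pca $\mathcal{A}$ and a partial function $f:\mathcal{A}\to\mathcal{A}$, $\mathcal{A}[f]$ is the pca with underlying set $\mathcal{A}$ and application $\cdot_f$ defined by: $a\cdot_f b=c$ iff there is a finite sequence $e_0,\ldots,e_{n-1}$ in $\mathcal{A}$ (on each of which $f$ is defined) such that $a[b,f(e_0),\ldots,f(e_{i-1})]=[\mathsf{F},e_i]$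 for all $i<n$ and $a[b,f(e_0),\ldots,f(e_{n-1})]=[\mathsf{T},c]$. (It is known that this is a pca, that $f$ is representable in it, and that application of $\mathcal{A}$ is representable in it.) Scott's graph model is the set $\mathcal{P}(\mathbb{N})$ with application $A\circ B=\{n\mid \exists m\,([m,n]\in A,\ e_m\subseteq B)\}$, where $[\cdot,\cdot]$ is a standard bijective pairing on $\mathbb{N}$ and $e_k$ is the finite set $p$ with $k=\sum_{i\in p}2^i$. The Cantor topology on $\mathcal{P}(\mathbb{N})$ has as basis the sets $U_p^q=\{A\subseteq\mathbb{N}\mid p\subseteq A,\ A\cap q=\emptyset\}$ for disjoint finite $p,q\subseteq\mathbb{N}$. -}

module Defs where

open import Level using (Level; _⊔_; 0ℓ) renaming (suc to lsuc)
open import Data.Empty using (⊥-elim)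
open import Data.Fin using (Fin; zero; suc; toℕ; fromℕ<)
import Data.Fin.Properties as Fin
open import Data.List as List using (List; []; _∷_; _++_; _∷ʳ_; length; lookup; map; take; tabulate)
import Data.List.Properties as List
open import Data.List.Membership.Propositional using () renaming (_∈_ to _∈ₗ_)
open import Data.List.Membership.Propositional.Properties
  using (∈-++⁺ˡ; ∈-++⁺ʳ; ∈-++⁻; ∈-deduplicate⁺; ∈-deduplicate⁻)
open import Data.List.Relation.Unary.All as All using (All; []; _∷_)
import Data.List.Relation.Unary.All.Properties as All
open import Data.List.Relation.Unary.AllPairs using ([]; _∷_)
open import Data.List.Relation.Unary.Any using (here; there)
open import Data.List.Relation.Unary.Unique.Propositional using (Unique)
import Data.List.Relation.Unary.Unique.Propositional.Properties as Unique
open import Data.List.Relation.Binary.Disjoint.Propositional using (Disjoint)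
open import Data.List.Relation.Binary.Pointwise as Pointwise using (Pointwise; []; _∷_)
open import Data.Nat using (ℕ; zero; suc; _+_; _*_; _^_; _≤_; _<_; z≤n; s≤s)
open import Data.Nat.DivMod using (_%_; m/n<m; m%n<n; m≡m%n+[m/n]*n)
open import Data.Nat.Induction using (<-rec)
open import Data.Nat.ListAction using (sum)
import Data.Nat.Properties as ℕ
open import Data.Nat.Tactic.RingSolver using (solve-∀)
open import Data.List.Relation.Unary.Unique.DecPropositional.Properties ℕ._≟_ using (deduplicate-!)
open import Data.Product using (∃₂; ∃-syntax; _×_; _,_; proj₁; proj₂)
open import Data.Sum using (_⊎_; inj₁; inj₂; [_,_]′)
open import Data.Unit.Polymorphic using (⊤)
open import Function using (id; _↔_; Inverse; _⇔_)
open import Relation.Binary.Bundles using (Setoid)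
open import Relation.Binary.Definitions using (tri<; tri≈; tri>)
open import Relation.Binary.PropositionalEquality as ≡ using (_≡_; refl; cong; cong₂; subst)
open import Relation.Nullary using (¬_)
open import Relation.Unary using (Pred; _∈_; _⊆_; _≐_; _∩_; ∁; ⋃; Empty)
open import Relation.Unary.Relation.Binary.Equality using (≐-setoid)

-- Partial operations are given by their graphs: x · y ↓ z says that xy is
-- defined and equal to z.
record ApplicativeStructure (c ℓ a : Level) : Set (lsuc (c ⊔ ℓ ⊔ a)) where
  infix 4 _·_↓_ _·_·_↓_ _·_·_·_↓_
  field
    setoid : Setoid c ℓ
  open Setoid setoid public
    renaming (refl to ≈-refl; sym to ≈-sym; trans to ≈-trans)
  field
    _·_↓_        : Carrier → Carrier → Carrier → Set a
    ↓-resp-≈     : ∀ {x x′ y y′ z z′} → x ≈ x′ → y ≈ y′ → z ≈ z′ →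
                   x · y ↓ z → x′ · y′ ↓ z′
    ↓-functional : ∀ {x y z z′} → x · y ↓ z → x · y ↓ z′ → z ≈ z′

  _·_·_↓_ : Carrier → Carrier → Carrier → Carrier → Set (c ⊔ a)
  x · y · z ↓ w = ∃[ u ] x · y ↓ u × u · z ↓ w

  _·_·_·_↓_ : Carrier → Carrier → Carrier → Carrier → Carrier → Set (c ⊔ a)
  x · y · z · v ↓ w = ∃[ u ] x · y ↓ u × u · z · v ↓ w

record IsPCA {c ℓ a : Level} (𝒜 : ApplicativeStructure c ℓ a) : Set (c ⊔ a) where
  open ApplicativeStructure 𝒜
  field
    k s       : Carrier
    k-law     : ∀ x y → k · x · y ↓ x
    s-defined : ∀ x y → ∃[ z ] s · x · y ↓ z
    s-law     : ∀ x y z {u v w} → x · z ↓ u → y · z ↓ v → u · v ↓ w →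
                s · x · y · z ↓ w

-- A choice of booleans, definition by cases, and codings of pairs, numbers
-- and finite sequences whose basic operations are representable. Numbers
-- are needed for the lengths of sequences and the indices of projections.
record Coding {c ℓ a : Level} (𝒜 : ApplicativeStructure c ℓ a) : Set (c ⊔ ℓ ⊔ a) where
  open ApplicativeStructure 𝒜
  field
    T F D : Carrier
    D-T   : ∀ x y → D · T · x · y ↓ x
    D-F   : ∀ x y → D · F · x · y ↓ y

    pair                 : Carrier → Carrier → Carrier
    pair-cong            : ∀ {x x′ y y′} → x ≈ x′ → y ≈ y′ → pair x y ≈ pair x′ y′
    pairing first second : Carrier
    pairing-law          : ∀ x y → pairing · x · y ↓ pair x y
    first-law            : ∀ x y → first · pair x y ↓ x
    second-law           : ∀ x y → second · pair x y ↓ y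

    numeral                      : ℕ → Carrier
    successor predecessor isZero : Carrier
    successor-law                : ∀ n → successor · numeral n ↓ numeral (suc n)
    predecessor-law              : ∀ n → predecessor · numeral (suc n) ↓ numeral n
    isZero-zero                  : isZero · numeral 0 ↓ T
    isZero-suc                   : ∀ n → isZero · numeral (suc n) ↓ F

    sequence                    : List Carrier → Carrier
    sequence-cong               : ∀ {xs ys} → Pointwise _≈_ xs ys → sequence xs ≈ sequence ys
    seqLength projection append : Carrier
    length-law                  : ∀ xs → seqLength · sequence xs ↓ numeral (length xs)
    projection-law              : ∀ xs (i : Fin (length xs)) →
                                  projection · numeral (toℕ i) · sequence xs ↓ lookup xs i
    append-law                  : ∀ xs x → append · sequence xs · x ↓ sequence (xs ∷ʳ x)

record PartialFunction {c ℓ : Level} (S : Setoid c ℓ) (r : Level) : Set (c ⊔ ℓ ⊔ lsuc r) where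
  open Setoid S using (Carrier; _≈_)
  field
    Graph            : Carrier → Carrier → Set r
    Graph-resp-≈     : ∀ {x x′ y y′} → x ≈ x′ → y ≈ y′ → Graph x y → Graph x′ y′
    Graph-functional : ∀ {x y y′} → Graph x y → Graph x y′ → y ≈ y′

Representable : {c ℓ a r : Level} (𝒜 : ApplicativeStructure c ℓ a) →
                PartialFunction (ApplicativeStructure.setoid 𝒜) r → Set (c ⊔ a ⊔ r)
Representable 𝒜 f = ∃[ x ] (∀ {y z} → Graph y z → x · y ↓ z)
  where open ApplicativeStructure 𝒜; open PartialFunction f

module Relative {c ℓ a r : Level} (𝒜 : ApplicativeStructure c ℓ a) (κ : Coding 𝒜)
                (f : PartialFunction (ApplicativeStructure.setoid 𝒜) r) where
  open ApplicativeStructure 𝒜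
  open Coding κ
  open PartialFunction f

  -- The queries are e₀, …, eₙ₋₁ and the answers are f(e₀), …, f(eₙ₋₁).
  record Computation (x y z : Carrier) : Set (c ⊔ a ⊔ r) where
    field
      n       : ℕ
      query   : Fin n → Carrier
      answer  : Fin n → Carrier
      answers : ∀ i → Graph (query i) (answer i)
      asks    : ∀ i → x · sequence (y ∷ take (toℕ i) (tabulate answer)) ↓ pair F (query i)
      halts   : x · sequence (y ∷ tabulate answer) ↓ pair T z

  private
    pair-injective : ∀ {x x′ y y′} → pair x y ≈ pair x′ y′ → x ≈ x′ × y ≈ y′
    pair-injective {x} {x′} {y} {y′} p =
      ↓-functional (first-law x y) (↓-resp-≈ ≈-refl (≈-sym p) ≈-refl (first-law x′ y′)) ,
      ↓-functional (second-law x y) (↓-resp-≈ ≈-refl (≈-sym p) ≈-refl (second-law x′ y′))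

    ↓-unique : ∀ {x x′ y y′ z z′} → x ≈ x′ → y ≈ y′ → x · y ↓ z → x′ · y′ ↓ z′ → z ≈ z′
    ↓-unique p q h h′ = ↓-functional (↓-resp-≈ p q ≈-refl h) h′

    T≈F⇒≈ : T ≈ F → ∀ x y → x ≈ y
    T≈F⇒≈ p x y with D-T x y | D-F x y
    ... | _ , h₁ , _ , h₂ , h₃ | _ , h₁′ , _ , h₂′ , h₃′ =
      ↓-unique (↓-unique (↓-unique ≈-refl p h₁ h₁′) ≈-refl h₂ h₂′) ≈-refl h₃ h₃′

    module _ {x y : Carrier} where
      open Computation

      answer-unique : ∀ {z z′} (h : Computation x y z) (h′ : Computation x y z′) i i′ →
                      toℕ i ≡ toℕ i′ →
                      Pointwise _≈_ (take (toℕ i) (tabulate (answer h))) (take (toℕ i) (tabulate (answer h′))) →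
                      answer h i ≈ answer h′ i′
      answer-unique h h′ i i′ i≡i′ p =
        Graph-functional (answers h i)
          (Graph-resp-≈ (≈-sym (proj₂ (pair-injective (↓-unique ≈-refl
            (sequence-cong (≈-refl ∷ p)) (asks h i) asks′)))) ≈-refl (answers h′ i′))
        where
        asks′ : x · sequence (y ∷ take (toℕ i) (tabulate (answer h′))) ↓ pair F (query h′ i′)
        asks′ rewrite i≡i′ = asks h′ i′

      answers-agree : ∀ {z z′} (h : Computation x y z) (h′ : Computation x y z′) →
                      ∀ i → i ≤ n h → i ≤ n h′ →
                      Pointwise _≈_ (take i (tabulate (answer h))) (take i (tabulate (answer h′)))
      answers-agree h h′ zero    _   _    = []
      answers-agree h h′ (suc i) i<n i<n′ =
        ≡.subst₂ (Pointwise _≈_) (take-suc h i<n) (take-suc h′ i<n′)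
          (Pointwise.++⁺ agree (answer-unique h h′ (fromℕ< i<n) (fromℕ< i<n′)
            (≡.trans (Fin.toℕ-fromℕ< i<n) (≡.sym (Fin.toℕ-fromℕ< i<n′)))
            (subst (λ j → Pointwise _≈_ (take j (tabulate (answer h))) (take j (tabulate (answer h′))))
              (≡.sym (Fin.toℕ-fromℕ< i<n)) agree) ∷ []))
        where
        agree : Pointwise _≈_ (take i (tabulate (answer h))) (take i (tabulate (answer h′)))
        agree = answers-agree h h′ i (ℕ.<⇒≤ i<n) (ℕ.<⇒≤ i<n′)

        take-suc : ∀ {z} (h : Computation x y z) (i<n : i < n h) →
                   take i (tabulate (answer h)) ∷ʳ answer h (fromℕ< i<n) ≡ take (suc i) (tabulate (answer h))
        take-suc h i<n = subst
          (λ j → take j (tabulate (answer h)) ∷ʳ answer h (fromℕ< i<n) ≡ take (suc j) (tabulate (answer h)))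
          (Fin.toℕ-fromℕ< i<n) (≡.sym (List.take-suc-tabulate (answer h) (fromℕ< i<n)))

      take-n : ∀ {z} (h : Computation x y z) → take (n h) (tabulate (answer h)) ≡ tabulate (answer h)
      take-n h = List.take-all (n h) _ (ℕ.≤-reflexive (List.length-tabulate (answer h)))

      halts-early : ∀ {z z′} (h : Computation x y z) (h′ : Computation x y z′) → n h < n h′ → T ≈ F
      halts-early h h′ n<n′ = proj₁ (pair-injective (↓-unique ≈-refl
        (sequence-cong (≈-refl ∷ subst (λ l → Pointwise _≈_ l (take (n h) (tabulate (answer h′))))
          (take-n h) (answers-agree h h′ (n h) ℕ.≤-refl (ℕ.<⇒≤ n<n′))))
        (halts h) asks′))
        where
        asks′ : x · sequence (y ∷ take (n h) (tabulate (answer h′))) ↓ pair F (query h′ (fromℕ< n<n′))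
        asks′ = subst (λ j → x · sequence (y ∷ take j (tabulate (answer h′))) ↓ pair F (query h′ (fromℕ< n<n′)))
          (Fin.toℕ-fromℕ< n<n′) (asks h′ (fromℕ< n<n′))

      Computation-functional : ∀ {z z′} → Computation x y z → Computation x y z′ → z ≈ z′
      Computation-functional h h′ with ℕ.<-cmp (n h) (n h′)
      ... | tri< n<n′ _ _ = T≈F⇒≈ (halts-early h h′ n<n′) _ _
      ... | tri> _ _ n′<n = T≈F⇒≈ (halts-early h′ h n′<n) _ _
      ... | tri≈ _ n≡n′ _ = proj₂ (pair-injective (↓-unique ≈-refl
        (sequence-cong (≈-refl ∷ ≡.subst₂ (Pointwise _≈_) (take-n h)
          (≡.trans (cong (λ j → take j (tabulate (answer h′))) n≡n′) (take-n h′))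
          (answers-agree h h′ (n h) ℕ.≤-refl (ℕ.≤-reflexive n≡n′))))
        (halts h) (halts h′)))

    Computation-resp-≈ : ∀ {x x′ y y′ z z′} → x ≈ x′ → y ≈ y′ → z ≈ z′ →
                         Computation x y z → Computation x′ y′ z′
    Computation-resp-≈ x≈ y≈ z≈ h = record
      { n       = n
      ; query   = query
      ; answer  = answer
      ; answers = answers
      ; asks    = λ i → ↓-resp-≈ x≈ (sequence-cong (y≈ ∷ Pointwise.refl ≈-refl)) ≈-refl (asks i)
      ; halts   = ↓-resp-≈ x≈ (sequence-cong (y≈ ∷ Pointwise.refl ≈-refl)) (pair-cong ≈-refl z≈) halts
      }
      where open Computation h

  structure : ApplicativeStructure c ℓ (c ⊔ a ⊔ r)
  structure = record
    { setoid       = setoid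
    ; _·_↓_        = Computation
    ; ↓-resp-≈     = Computation-resp-≈
    ; ↓-functional = Computation-functional
    }

infix 10 _[_,_]

_[_,_] : {c ℓ a r : Level} (𝒜 : ApplicativeStructure c ℓ a) → Coding 𝒜 →
         PartialFunction (ApplicativeStructure.setoid 𝒜) r → ApplicativeStructure c ℓ (c ⊔ a ⊔ r)
𝒜 [ κ , f ] = Relative.structure 𝒜 κ f

record Topology {c ℓ : Level} (S : Setoid c ℓ) : Set (lsuc (lsuc c) ⊔ ℓ) where
  open Setoid S using (Carrier; _≈_)
  field
    IsOpen : Pred (Pred Carrier c) c
    resp-≈ : ∀ {V} → IsOpen V → ∀ {x y} → x ≈ y → V x → V y
    resp-≐ : ∀ {V W} → V ≐ W → IsOpen V → IsOpen W
    whole  : IsOpen (λ _ → ⊤)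
    inter  : ∀ {V W} → IsOpen V → IsOpen W → IsOpen (V ∩ W)
    union  : ∀ {I : Set c} {V : I → Pred Carrier c} → (∀ i → IsOpen (V i)) → IsOpen (⋃ I V)

-- The domain carries the subspace topology: its open sets are the traces
-- of the open sets W below.
ContinuousOnDomain : {c ℓ r : Level} {S : Setoid c ℓ} → Topology S → PartialFunction S r → Set (lsuc c ⊔ r)
ContinuousOnDomain τ f =
  ∀ V → IsOpen V → ∃[ W ] IsOpen W × (∀ {x y} → Graph x y → W x ⇔ V y)
  where open Topology τ; open PartialFunction f

-- The definition refers to the application of the pca only, so it is stated
-- for applicative structures. The graph of f lives at the level of the
-- carrier; under excluded middle every relation is equivalent to one at that
-- level, so all partial functions are covered.
IsConrep : {c ℓ a : Level} (𝒜 : ApplicativeStructure c ℓ a) →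
           Topology (ApplicativeStructure.setoid 𝒜) → Set (lsuc c ⊔ ℓ ⊔ a)
IsConrep {c} 𝒜 τ =
  ∀ (f : PartialFunction (ApplicativeStructure.setoid 𝒜) c) → ContinuousOnDomain τ f → Representable 𝒜 f

weight : List ℕ → ℕ
weight p = sum (map (2 ^_) p)

-- e k is the finite set p with k = Σ_{i ∈ p} 2^i; finite sets are
-- represented by repetition-free lists.
e : ℕ → Pred ℕ 0ℓ
e k i = ∃[ p ] Unique p × k ≡ weight p × i ∈ₗ p

private
  half : List ℕ → List ℕ
  half []          = []
  half (zero  ∷ p) = half p
  half (suc i ∷ p) = i ∷ half p

  zeros : List ℕ → ℕ
  zeros []          = 0
  zeros (zero  ∷ p) = suc (zeros p)
  zeros (suc _ ∷ p) = zeros p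

  weight-split : ∀ p → weight p ≡ zeros p + 2 * weight (half p)
  weight-split []          = refl
  weight-split (zero  ∷ p) = cong suc (weight-split p)
  weight-split (suc i ∷ p) rewrite weight-split p = lemma (2 ^ i) (zeros p) (weight (half p))
    where
    lemma : ∀ a b c → 2 * a + (b + 2 * c) ≡ b + 2 * (a + c)
    lemma = solve-∀

  ∈-half⁺ : ∀ {i} p → suc i ∈ₗ p → i ∈ₗ half p
  ∈-half⁺ (zero  ∷ p) (there h)   = ∈-half⁺ p h
  ∈-half⁺ (suc j ∷ p) (here refl) = here refl
  ∈-half⁺ (suc j ∷ p) (there h)   = there (∈-half⁺ p h)

  ∈-half⁻ : ∀ {i} p → i ∈ₗ half p → suc i ∈ₗ p
  ∈-half⁻ (zero  ∷ p) h           = there (∈-half⁻ p h)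
  ∈-half⁻ (suc j ∷ p) (here refl) = here refl
  ∈-half⁻ (suc j ∷ p) (there h)   = there (∈-half⁻ p h)

  zero∈⇒zeros : ∀ {p} → 0 ∈ₗ p → ∃[ m ] zeros p ≡ suc m
  zero∈⇒zeros (here refl)           = _ , refl
  zero∈⇒zeros {zero  ∷ p} (there h) = _ , refl
  zero∈⇒zeros {suc _ ∷ p} (there h) = zero∈⇒zeros h

  zeros⇒zero∈ : ∀ p {m} → zeros p ≡ suc m → 0 ∈ₗ p
  zeros⇒zero∈ (zero  ∷ p) h = here refl
  zeros⇒zero∈ (suc _ ∷ p) h = there (zeros⇒zero∈ p h)

  unique-half : ∀ {p} → Unique p → Unique (half p)
  unique-half []                     = []
  unique-half {zero  ∷ p} (_  ∷ u)   = unique-half u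
  unique-half {suc i ∷ p} (i∉ ∷ u)   =
    All.tabulate (λ j∈ i≡j → All.lookup i∉ (∈-half⁻ p j∈) (cong suc i≡j)) ∷ unique-half u

  unique-zeros : ∀ {p} → Unique p → zeros p ≤ 1
  unique-zeros []                   = z≤n
  unique-zeros {suc _ ∷ p} (_ ∷ u)  = unique-zeros u
  unique-zeros {zero  ∷ p} (0∉ ∷ u) with zeros p in eq
  ... | zero  = s≤s z≤n
  ... | suc _ = ⊥-elim (All.lookup 0∉ (zeros⇒zero∈ p eq) refl)

  digit : ∀ {a b} c d → a ≤ 1 → b ≤ 1 → a + 2 * c ≡ b + 2 * d → a ≡ b × c ≡ d
  digit c d z≤n       z≤n       h = refl , ℕ.*-cancelˡ-≡ c d 2 h
  digit c d (s≤s z≤n) (s≤s z≤n) h = refl , ℕ.*-cancelˡ-≡ c d 2 (ℕ.suc-injective h)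
  digit c d z≤n       (s≤s z≤n) h = ⊥-elim (ℕ.even≢odd c d h)
  digit c d (s≤s z≤n) z≤n       h = ⊥-elim (ℕ.even≢odd d c (≡.sym h))

  weight-unique : ∀ i {p q} → Unique p → Unique q → weight p ≡ weight q → i ∈ₗ p → i ∈ₗ q
  weight-unique i {p} {q} u v h i∈p
    with digit (weight (half p)) (weight (half q)) (unique-zeros u) (unique-zeros v)
           (≡.trans (≡.sym (weight-split p)) (≡.trans h (weight-split q)))
  weight-unique zero    {p} {q} u v h i∈p | eq , _ =
    zeros⇒zero∈ q (≡.trans (≡.sym eq) (proj₂ (zero∈⇒zeros i∈p)))
  weight-unique (suc i) {p} {q} u v h i∈p | _ , eq =
    ∈-half⁻ q (weight-unique i (unique-half u) (unique-half v) eq (∈-half⁺ p i∈p))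

  weight-map-suc : ∀ p → weight (map suc p) ≡ 2 * weight p
  weight-map-suc []      = refl
  weight-map-suc (i ∷ p) rewrite weight-map-suc p = ≡.sym (ℕ.*-distribˡ-+ 2 (2 ^ i) (weight p))

  binary : ∀ k → ∃[ p ] Unique p × k ≡ weight p
  binary = <-rec _ step
    where
    step : ∀ k → (∀ {j} → j < k → ∃[ p ] Unique p × j ≡ weight p) → ∃[ p ] Unique p × k ≡ weight p
    step zero    rec = [] , [] , refl
    step (suc k) rec with rec (m/n<m (suc k) 2 (s≤s (s≤s z≤n))) | suc k % 2 in eq | m%n<n (suc k) 2
    ... | p , u , h | 0 | _ = map suc p , Unique.map⁺ ℕ.suc-injective u ,
      ≡.trans (m≡m%n+[m/n]*n (suc k) 2)
        (≡.trans (cong₂ (λ a b → a + b * 2) eq h)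
          (≡.trans (ℕ.*-comm (weight p) 2) (≡.sym (weight-map-suc p))))
    ... | p , u , h | 1 | _ =
      0 ∷ map suc p ,
      All.map⁺ (All.universal (λ _ ()) p) ∷ Unique.map⁺ ℕ.suc-injective u ,
      ≡.trans (m≡m%n+[m/n]*n (suc k) 2)
        (≡.trans (cong₂ (λ a b → a + b * 2) eq h)
          (cong suc (≡.trans (ℕ.*-comm (weight p) 2) (≡.sym (weight-map-suc p)))))
    ... | _ | suc (suc _) | s≤s (s≤s ())

e-finite : ∀ k → ∃[ p ] (_∈ₗ p) ≐ e k
e-finite k with p , u , h ← binary k =
  p , (λ i∈p → p , u , h , i∈p) , λ (q , v , h′ , i∈q) → weight-unique _ v u (≡.trans (≡.sym h′) h) i∈q

e-surjective : ∀ p → ∃[ k ] e k ≐ (_∈ₗ p)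
e-surjective p =
  weight q ,
  (λ (q′ , v , h , i∈q′) → ∈-deduplicate⁻ ℕ._≟_ p (weight-unique _ v u (≡.sym h) i∈q′)) ,
  (λ i∈p → q , u , refl , ∈-deduplicate⁺ ℕ._≟_ i∈p)
  where
  q : List ℕ
  q = List.deduplicate ℕ._≟_ p
  u : Unique q
  u = deduplicate-! p

𝒫ℕ : Set₁
𝒫ℕ = Pred ℕ 0ℓ

𝒫ℕ-setoid : Setoid (lsuc 0ℓ) 0ℓ
𝒫ℕ-setoid = ≐-setoid ℕ 0ℓ

complement : PartialFunction 𝒫ℕ-setoid 0ℓ
complement = record
  { Graph            = λ A B → B ≐ ∁ A
  ; Graph-resp-≈     = λ (A⊆ , ⊇A) (B⊆ , ⊇B) (h , h′) →
      (λ b a → h (⊇B b) (⊇A a)) , (λ n∉A → B⊆ (h′ (λ a → n∉A (A⊆ a))))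
  ; Graph-functional = λ (h , h′) (g , g′) → (λ x → g′ (h x)) , (λ x → h′ (g x))
  }

U[_,_] : List ℕ → List ℕ → Pred 𝒫ℕ 0ℓ
U[ p , q ] A = (_∈ₗ p) ⊆ A × Empty (A ∩ (_∈ₗ q))

-- The topology with the sets U[ p , q ], for disjoint p and q, as basis.
cantor : Topology 𝒫ℕ-setoid
cantor = record
  { IsOpen = λ V → ∀ {A} → A ∈ V → ∃₂ λ p q → Disjoint p q × A ∈ U[ p , q ] × U[ p , q ] ⊆ V
  ; resp-≈ = λ V-open (A⊆B , B⊆A) A∈V →
      let _ , _ , _ , (p⊆A , A∩q) , ⊆V = V-open A∈V
      in ⊆V ((λ i → A⊆B (p⊆A i)) , λ i (b , i∈q) → A∩q i (B⊆A b , i∈q))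
  ; resp-≐ = λ (V⊆W , W⊆V) V-open A∈W →
      let p , q , disj , A∈ , ⊆V = V-open (W⊆V A∈W) in p , q , disj , A∈ , λ h → V⊆W (⊆V h)
  ; whole  = λ _ → [] , [] , (λ ()) , ((λ ()) , λ _ ()) , λ _ → _
  ; inter  = λ V-open W-open (A∈V , A∈W) →
      let p  , q  , _ , (p⊆A  , A∩q)  , ⊆V = V-open A∈V
          p′ , q′ , _ , (p′⊆A , A∩q′) , ⊆W = W-open A∈W
          sub = λ {i} (h : i ∈ₗ p ++ p′) → [ p⊆A , p′⊆A ]′ (∈-++⁻ p h)
          dis = λ i (a , h) → [ (λ i∈q → A∩q i (a , i∈q)) , (λ i∈q′ → A∩q′ i (a , i∈q′)) ]′ (∈-++⁻ q h)
      in p ++ p′ , q ++ q′ , (λ (h , h′) → dis _ (sub h , h′)) , (sub , dis) ,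
         λ (⊆B , B∩) →
           ⊆V ((λ h → ⊆B (∈-++⁺ˡ h))   , λ i (b , h) → B∩ i (b , ∈-++⁺ˡ h)) ,
           ⊆W ((λ h → ⊆B (∈-++⁺ʳ p h)) , λ i (b , h) → B∩ i (b , ∈-++⁺ʳ q h))
  ; union  = λ V-open (i , A∈Vi) →
      let p , q , disj , A∈ , ⊆Vi = V-open i A∈Vi in p , q , disj , A∈ , λ h → i , ⊆Vi h
  }

-- Openness in the Scott topology, by monotonicity and compactness; the
-- continuous maps are the representable ones.
record ScottOpen (φ : 𝒫ℕ → Set) : Set₁ where
  field
    mono    : ∀ {A B} → A ⊆ B → φ A → φ B
    compact : ∀ {A} → φ A → ∃[ p ] (_∈ₗ p) ⊆ A × φ (_∈ₗ p)

ScottContinuous : (𝒫ℕ → 𝒫ℕ) → Set₁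
ScottContinuous G = ∀ n → ScottOpen (λ A → n ∈ G A)

open ScottOpen

const-open : ∀ {Q : Set} → ScottOpen (λ _ → Q)
const-open .mono _ h  = h
const-open .compact h = [] , (λ ()) , h

∈-open : ∀ n → ScottOpen (n ∈_)
∈-open n .mono A⊆B h = A⊆B h
∈-open n .compact h  = n ∷ [] , (λ { (here refl) → h }) , here refl

×-open : ∀ {φ ψ} → ScottOpen φ → ScottOpen ψ → ScottOpen (λ A → φ A × ψ A)
×-open f g .mono A⊆B (h , h′) = f .mono A⊆B h , g .mono A⊆B h′
×-open f g .compact (h , h′) =
  let p , p⊆ , hp = f .compact h
      q , q⊆ , hq = g .compact h′
  in p ++ q , (λ i → [ p⊆ , q⊆ ]′ (∈-++⁻ p i)) , f .mono ∈-++⁺ˡ hp , g .mono (∈-++⁺ʳ p) hq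

⊎-open : ∀ {φ ψ} → ScottOpen φ → ScottOpen ψ → ScottOpen (λ A → φ A ⊎ ψ A)
⊎-open f g .mono A⊆B (inj₁ h)  = inj₁ (f .mono A⊆B h)
⊎-open f g .mono A⊆B (inj₂ h)  = inj₂ (g .mono A⊆B h)
⊎-open f g .compact (inj₁ h) = let p , p⊆ , hp = f .compact h in p , p⊆ , inj₁ hp
⊎-open f g .compact (inj₂ h) = let p , p⊆ , hp = g .compact h in p , p⊆ , inj₂ hp

∃-open : ∀ {I : Set} {φ : I → 𝒫ℕ → Set} → (∀ i → ScottOpen (φ i)) → ScottOpen (λ A → ∃[ i ] φ i A)
∃-open f .mono A⊆B (i , h) = i , f i .mono A⊆B h
∃-open f .compact (i , h)  = let p , p⊆ , hp = f i .compact h in p , p⊆ , i , hp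

e⊆-open : ∀ {G} m → ScottContinuous G → ScottOpen (λ A → e m ⊆ G A)
e⊆-open {G} m f .mono A⊆B h i∈e = f _ .mono A⊆B (h i∈e)
e⊆-open {G} m f .compact h =
  let p , p⊆ , hp = all-open {q} .compact (All.tabulate (λ i∈q → h (q⊆e i∈q)))
  in p , p⊆ , λ i∈e → All.lookup hp (e⊆q i∈e)
  where
  q   = proj₁ (e-finite m)
  q⊆e = proj₁ (proj₂ (e-finite m))
  e⊆q = proj₂ (proj₂ (e-finite m))

  all-open : ∀ {q} → ScottOpen (λ A → All (_∈ G A) q)
  all-open .mono A⊆B h                 = All.map (f _ .mono A⊆B) h
  all-open {[]}    .compact []         = [] , (λ ()) , []
  all-open {i ∷ q} .compact (h ∷ hs)   =
    let p , p⊆ , hp , hps = ×-open (f i) (all-open {q}) .compact (h , hs) in p , p⊆ , hp ∷ hps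

module GraphModel (π : (ℕ × ℕ) ↔ ℕ) where

  ⟨_,_⟩ : ℕ → ℕ → ℕ
  ⟨ m , n ⟩ = Inverse.to π (m , n)

  infixl 7 _∙_

  _∙_ : 𝒫ℕ → 𝒫ℕ → 𝒫ℕ
  (A ∙ B) n = ∃[ m ] ⟨ m , n ⟩ ∈ A × e m ⊆ B

  ∙-cong : ∀ {A A′ B B′} → A ≐ A′ → B ≐ B′ → A ∙ B ≐ A′ ∙ B′
  ∙-cong (A⊆ , ⊇A) (B⊆ , ⊇B) =
    (λ (m , h , h′) → m , A⊆ h , λ i → B⊆ (h′ i)) ,
    (λ (m , h , h′) → m , ⊇A h , λ i → ⊇B (h′ i))

  structure : ApplicativeStructure (lsuc 0ℓ) 0ℓ 0ℓ
  structure = record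
    { setoid       = 𝒫ℕ-setoid
    ; _·_↓_        = λ A B C → A ∙ B ≐ C
    ; ↓-resp-≈     = λ A≐ B≐ C≐ h → S.trans (S.sym (∙-cong A≐ B≐)) (S.trans h C≐)
    ; ↓-functional = λ h h′ → S.trans (S.sym h) h′
    }
    where module S = Setoid 𝒫ℕ-setoid

  abs : (𝒫ℕ → 𝒫ℕ) → 𝒫ℕ
  abs G x = let m , n = Inverse.from π x in n ∈ G (e m)

  abs-∙ : ∀ {G} → ScottContinuous G → ∀ A → abs G ∙ A ≐ G A
  abs-∙ {G} f A =
    (λ (m , h , e⊆A) → f _ .mono e⊆A (subst (λ (m , n) → n ∈ G (e m)) (Inverse.strictlyInverseʳ π _) h)) ,
    (λ h → let p , p⊆A , hp = f _ .compact h
               k , e⊆p , p⊆e = e-surjective p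
           in k , subst (λ (m , n) → n ∈ G (e m)) (≡.sym (Inverse.strictlyInverseʳ π _)) (f _ .mono p⊆e hp) ,
              λ i → p⊆A (e⊆p i))

  id-continuous : ScottContinuous id
  id-continuous = ∈-open

  const-continuous : ∀ B → ScottContinuous (λ _ → B)
  const-continuous B n = const-open

  ∙-continuous : ∀ {G H} → ScottContinuous G → ScottContinuous H → ScottContinuous (λ A → G A ∙ H A)
  ∙-continuous f g n = ∃-open (λ m → ×-open (f ⟨ m , n ⟩) (e⊆-open m g))

  abs-continuous : ∀ {G : 𝒫ℕ → 𝒫ℕ → 𝒫ℕ} → (∀ B → ScottContinuous (λ A → G A B)) →
                   ScottContinuous (λ A → abs (G A))
  abs-continuous f x = let m , n = Inverse.from π x in f (e m) n

  open ApplicativeStructure structure using (_·_·_↓_; _·_·_·_↓_)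

  private module S = Setoid 𝒫ℕ-setoid

  abs₂-law : ∀ (G : 𝒫ℕ → 𝒫ℕ → 𝒫ℕ) → (∀ B → ScottContinuous (λ A → G A B)) → (∀ A → ScottContinuous (G A)) →
             ∀ A B {C} → G A B ≐ C → abs (λ A → abs (G A)) · A · B ↓ C
  abs₂-law G f g A B h =
    _ , abs-∙ {λ A → abs (G A)} (abs-continuous f) A , S.trans (abs-∙ {G A} (g A) B) h

  abs₃-law : ∀ (G : 𝒫ℕ → 𝒫ℕ → 𝒫ℕ → 𝒫ℕ) → (∀ B C → ScottContinuous (λ A → G A B C)) →
             (∀ A C → ScottContinuous (λ B → G A B C)) → (∀ A B → ScottContinuous (G A B)) →
             ∀ A B C {D} → G A B C ≐ D → abs (λ A → abs (λ B → abs (G A B))) · A · B · C ↓ D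
  abs₃-law G f g h A B C p =
    _ , abs-∙ {λ A → abs (λ B → abs (G A B))} (abs-continuous (λ B → abs-continuous (f B))) A ,
    abs₂-law (G A) (g A) (h A) B C p

  isPCA : IsPCA structure
  isPCA = record
    { k         = abs (λ A → abs (λ B → A))
    ; s         = abs (λ A → abs (λ B → abs (λ C → (A ∙ C) ∙ (B ∙ C))))
    ; k-law     = λ A B → abs₂-law (λ A _ → A) (λ _ → id-continuous) const-continuous A B S.refl
    ; s-defined = λ A B → let _ , p , D , q , _ = s-law′ A B A S.refl in D , _ , p , q
    ; s-law     = λ A B C h h′ h″ → s-law′ A B C (S.trans (∙-cong h h′) h″)
    }
    where
    s-law′ : ∀ A B C {D} → (A ∙ C) ∙ (B ∙ C) ≐ D →
             abs (λ A → abs (λ B → abs (λ C → (A ∙ C) ∙ (B ∙ C)))) · A · B · C ↓ D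
    s-law′ = abs₃-law (λ A B C → (A ∙ C) ∙ (B ∙ C))
      (λ B C → ∙-continuous (∙-continuous id-continuous (const-continuous C)) (const-continuous (B ∙ C)))
      (λ A C → ∙-continuous (const-continuous (A ∙ C)) (∙-continuous id-continuous (const-continuous C)))
      (λ A B → ∙-continuous (∙-continuous (const-continuous A) id-continuous)
                            (∙-continuous (const-continuous B) id-continuous))

  -- Codings exist: here the number n is the singleton {n}, and pairs and
  -- sequences are disjoint unions.
  coding : Coding structure
  coding = record
    { T               = ⟦ 1 ⟧
    ; F               = ⟦ 0 ⟧
    ; D               = abs λ X → abs λ A → abs λ B → cases X A B
    ; D-T             = λ A B → D-law ⟦ 1 ⟧ A B
        ((λ { (inj₁ (_ , h)) → h ; (inj₂ (() , _)) }) , λ h → inj₁ (refl , h))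
    ; D-F             = λ A B → D-law ⟦ 0 ⟧ A B
        ((λ { (inj₁ (() , _)) ; (inj₂ (_ , h)) → h }) , λ h → inj₂ (refl , h))
    ; pair            = pair
    ; pair-cong       = λ (A⊆ , ⊇A) (B⊆ , ⊇B) → pair-mono A⊆ B⊆ , pair-mono ⊇A ⊇B
    ; pairing         = abs λ A → abs λ B → pair A B
    ; first           = abs (component 0)
    ; second          = abs (component 1)
    ; pairing-law     = λ A B →
        abs₂-law pair
          (λ B x → ⊎-open (∃-open λ n → ×-open const-open (∈-open n)) const-open)
          (λ A x → ⊎-open const-open (∃-open λ n → ×-open const-open (∈-open n))) A B S.refl
    ; first-law       = λ A B → S.trans (abs-∙ (λ n → ∈-open _) (pair A B))
        ( (λ { (inj₁ (_ , p , h)) → transport A p h ; (inj₂ (_ , p , h)) → ⊥-elim (0≢1 (fst≡ p)) })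
        , λ h → inj₁ (_ , refl , h))
    ; second-law      = λ A B → S.trans (abs-∙ (λ n → ∈-open _) (pair A B))
        ( (λ { (inj₁ (_ , p , h)) → ⊥-elim (0≢1 (≡.sym (fst≡ p))) ; (inj₂ (_ , p , h)) → transport B p h })
        , λ h → inj₂ (_ , refl , h))
    ; numeral         = ⟦_⟧
    ; successor       = abs image-suc
    ; predecessor     = abs λ X n → suc n ∈ X
    ; isZero          = abs λ X n → n ≡ 1 × 0 ∈ X ⊎ n ≡ 0 × (∃[ m ] suc m ∈ X)
    ; successor-law   = λ k → S.trans (abs-∙ {image-suc} (λ n → ∃-open λ m → ×-open const-open (∈-open m)) ⟦ k ⟧)
        ((λ { (_ , refl , refl) → refl }) , λ { refl → _ , refl , refl })
    ; predecessor-law = λ k → S.trans (abs-∙ (λ n → ∈-open (suc n)) ⟦ suc k ⟧)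
        (ℕ.suc-injective , cong suc)
    ; isZero-zero     = S.trans (abs-∙ isZero-continuous ⟦ 0 ⟧)
        ((λ { (inj₁ (h , _)) → h ; (inj₂ (_ , _ , ())) }) , λ h → inj₁ (h , refl))
    ; isZero-suc      = λ k → S.trans (abs-∙ isZero-continuous ⟦ suc k ⟧)
        ((λ { (inj₁ (_ , ())) ; (inj₂ (h , _)) → h }) , λ h → inj₂ (h , _ , refl))
    ; sequence        = sequence
    ; sequence-cong   = λ h → sequence-mono (Pointwise.map proj₁ h) ,
                              sequence-mono (Pointwise.symmetric proj₂ h)
    ; seqLength       = abs (component 0)
    ; projection      = abs λ I → abs λ X → nth I X
    ; append          = abs λ X → abs λ A → snoc X A
    ; length-law      = λ As → S.trans (abs-∙ (λ n → ∈-open _) (sequence As))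
        ( (λ { (inj₁ p) → snd≡ p ; (inj₂ (_ , _ , p , _)) → ⊥-elim (ℕ.0≢1+n (fst≡ p)) })
        , λ { refl → inj₁ refl })
    ; projection-law  = λ As i →
        abs₂-law nth
          (λ X n → ∃-open λ i → ×-open (∈-open i) const-open)
          (λ I n → ∃-open λ i → ×-open const-open (∈-open _))
          ⟦ toℕ i ⟧ (sequence As)
          ( (λ { (_ , refl , inj₁ p) → ⊥-elim (ℕ.0≢1+n (≡.sym (fst≡ p)))
               ; (_ , refl , inj₂ (j , _ , p , h)) →
                   transport (lookup As i) p
                     (subst (λ j → _ ∈ lookup As j) (≡.sym (Fin.toℕ-injective (ℕ.suc-injective (fst≡ p)))) h) })
          , λ h → _ , refl , inj₂ (i , _ , refl , h))
    ; append-law      = λ As A →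
        abs₂-law snoc
          (λ A x → ⊎-open (∃-open λ k → ×-open const-open (∈-open _))
                     (⊎-open (∃-open λ i → ∃-open λ n → ×-open const-open (∈-open _))
                             (∃-open λ k → ∃-open λ n → ×-open const-open (×-open (∈-open _) const-open))))
          (λ X x → ⊎-open const-open
                     (⊎-open const-open
                             (∃-open λ k → ∃-open λ n → ×-open const-open (×-open const-open (∈-open n)))))
          (sequence As) A
          (snoc-sequence As A)
    }
    where
    ⟦_⟧ : ℕ → 𝒫ℕ
    ⟦ n ⟧ = _≡ n

    0≢1 : ¬ 0 ≡ 1
    0≢1 ()

    ⟨⟩-injective : ∀ {m n m′ n′} → ⟨ m , n ⟩ ≡ ⟨ m′ , n′ ⟩ → (m , n) ≡ (m′ , n′)
    ⟨⟩-injective p = ≡.trans (≡.sym (Inverse.strictlyInverseʳ π _))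
                       (≡.trans (cong (Inverse.from π) p) (Inverse.strictlyInverseʳ π _))

    fst≡ : ∀ {m n m′ n′} → ⟨ m , n ⟩ ≡ ⟨ m′ , n′ ⟩ → m ≡ m′
    fst≡ p = cong proj₁ (⟨⟩-injective p)

    snd≡ : ∀ {m n m′ n′} → ⟨ m , n ⟩ ≡ ⟨ m′ , n′ ⟩ → n ≡ n′
    snd≡ p = cong proj₂ (⟨⟩-injective p)

    transport : ∀ (A : 𝒫ℕ) {m n m′ n′} → ⟨ m , n ⟩ ≡ ⟨ m′ , n′ ⟩ → n′ ∈ A → n ∈ A
    transport A p h = subst A (≡.sym (snd≡ p)) h

    image-suc : 𝒫ℕ → 𝒫ℕ
    image-suc X n = ∃[ m ] n ≡ suc m × m ∈ X

    cases : 𝒫ℕ → 𝒫ℕ → 𝒫ℕ → 𝒫ℕ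
    cases X A B n = 1 ∈ X × n ∈ A ⊎ 0 ∈ X × n ∈ B

    D-law : ∀ X A B {C} → cases X A B ≐ C → abs (λ X → abs (λ A → abs (cases X A))) · X · A · B ↓ C
    D-law = abs₃-law cases
      (λ A B n → ⊎-open (×-open (∈-open 1) const-open) (×-open (∈-open 0) const-open))
      (λ X B n → ⊎-open (×-open const-open (∈-open n)) const-open)
      (λ X A n → ⊎-open const-open (×-open const-open (∈-open n)))

    nth : 𝒫ℕ → 𝒫ℕ → 𝒫ℕ
    nth I X n = ∃[ i ] i ∈ I × ⟨ suc i , n ⟩ ∈ X

    component : ℕ → 𝒫ℕ → 𝒫ℕ
    component i X n = ⟨ i , n ⟩ ∈ X

    pair : 𝒫ℕ → 𝒫ℕ → 𝒫ℕ
    pair A B x = (∃[ n ] x ≡ ⟨ 0 , n ⟩ × n ∈ A) ⊎ (∃[ n ] x ≡ ⟨ 1 , n ⟩ × n ∈ B)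

    pair-mono : ∀ {A A′ B B′} → A ⊆ A′ → B ⊆ B′ → pair A B ⊆ pair A′ B′
    pair-mono f g (inj₁ (n , p , h)) = inj₁ (n , p , f h)
    pair-mono f g (inj₂ (n , p , h)) = inj₂ (n , p , g h)

    isZero-continuous : ScottContinuous (λ X n → n ≡ 1 × 0 ∈ X ⊎ n ≡ 0 × (∃[ m ] suc m ∈ X))
    isZero-continuous n = ⊎-open (×-open const-open (∈-open 0))
                                 (×-open const-open (∃-open λ m → ∈-open (suc m)))

    sequence : List 𝒫ℕ → 𝒫ℕ
    sequence As x = x ≡ ⟨ 0 , length As ⟩ ⊎
                    (∃[ i ] ∃[ n ] x ≡ ⟨ suc (toℕ i) , n ⟩ × n ∈ lookup As i)

    lookup-mono : ∀ {As Bs} → Pointwise _⊆_ As Bs → ∀ i {n} → n ∈ lookup As i →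
                  ∃[ j ] toℕ i ≡ toℕ j × n ∈ lookup Bs j
    lookup-mono (A⊆B ∷ _) zero    h = zero , refl , A⊆B h
    lookup-mono (_ ∷ hs)  (suc i) h =
      let j , p , h′ = lookup-mono hs i h in suc j , cong suc p , h′

    sequence-mono : ∀ {As Bs} → Pointwise _⊆_ As Bs → sequence As ⊆ sequence Bs
    sequence-mono hs (inj₁ p)               = inj₁ (≡.trans p (cong ⟨ 0 ,_⟩ (Pointwise.Pointwise-length hs)))
    sequence-mono hs (inj₂ (i , n , p , h)) =
      let j , q , h′ = lookup-mono hs i h
      in inj₂ (j , n , ≡.trans p (cong (λ i → ⟨ suc i , n ⟩) q) , h′)

    snoc : 𝒫ℕ → 𝒫ℕ → 𝒫ℕ
    snoc X A x =
      (∃[ k ] x ≡ ⟨ 0 , suc k ⟩ × ⟨ 0 , k ⟩ ∈ X) ⊎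
      (∃[ i ] ∃[ n ] x ≡ ⟨ suc i , n ⟩ × ⟨ suc i , n ⟩ ∈ X) ⊎
      (∃[ k ] ∃[ n ] x ≡ ⟨ suc k , n ⟩ × ⟨ 0 , k ⟩ ∈ X × n ∈ A)

    lookup-∷ʳ⁺ : ∀ (As : List 𝒫ℕ) {A} i {n} → n ∈ lookup As i →
                 ∃[ j ] toℕ i ≡ toℕ j × n ∈ lookup (As ∷ʳ A) j
    lookup-∷ʳ⁺ (_ ∷ As) zero    h = zero , refl , h
    lookup-∷ʳ⁺ (_ ∷ As) (suc i) h =
      let j , p , h′ = lookup-∷ʳ⁺ As i h in suc j , cong suc p , h′

    lookup-∷ʳ-last : ∀ (As : List 𝒫ℕ) {A n} → n ∈ A →
                     ∃[ j ] length As ≡ toℕ j × n ∈ lookup (As ∷ʳ A) j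
    lookup-∷ʳ-last []       h = zero , refl , h
    lookup-∷ʳ-last (_ ∷ As) h =
      let j , p , h′ = lookup-∷ʳ-last As h in suc j , cong suc p , h′

    lookup-∷ʳ⁻ : ∀ (As : List 𝒫ℕ) {A} i {n} → n ∈ lookup (As ∷ʳ A) i →
                 (∃[ j ] toℕ i ≡ toℕ j × n ∈ lookup As j) ⊎ (toℕ i ≡ length As × n ∈ A)
    lookup-∷ʳ⁻ []       zero    h = inj₂ (refl , h)
    lookup-∷ʳ⁻ (_ ∷ As) zero    h = inj₁ (zero , refl , h)
    lookup-∷ʳ⁻ (_ ∷ As) (suc i) h with lookup-∷ʳ⁻ As i h
    ... | inj₁ (j , p , h′) = inj₁ (suc j , cong suc p , h′)
    ... | inj₂ (p , h′)     = inj₂ (cong suc p , h′)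

    snoc-sequence : ∀ As A → snoc (sequence As) A ≐ sequence (As ∷ʳ A)
    snoc-sequence As A = to , from
      where
      length-∷ʳ : length (As ∷ʳ A) ≡ suc (length As)
      length-∷ʳ = ≡.trans (List.length-++ As) (ℕ.+-comm (length As) 1)

      to : snoc (sequence As) A ⊆ sequence (As ∷ʳ A)
      to (inj₁ (k , p , inj₁ q)) =
        inj₁ (≡.trans p (cong ⟨ 0 ,_⟩ (≡.trans (cong suc (snd≡ q)) (≡.sym length-∷ʳ))))
      to (inj₁ (k , p , inj₂ (_ , _ , q , _))) = ⊥-elim (ℕ.0≢1+n (fst≡ q))
      to (inj₂ (inj₁ (i , n , p , inj₁ q))) = ⊥-elim (ℕ.0≢1+n (≡.sym (fst≡ q)))
      to (inj₂ (inj₁ (i , n , p , inj₂ (j , m , q , h)))) =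
        let j′ , r , h′ = lookup-∷ʳ⁺ As j h
        in inj₂ (j′ , m , ≡.trans p (≡.trans q (cong (λ i → ⟨ suc i , m ⟩) r)) , h′)
      to (inj₂ (inj₂ (k , n , p , inj₁ q , h))) =
        let j , r , h′ = lookup-∷ʳ-last As h
        in inj₂ (j , n , ≡.trans p (cong (λ i → ⟨ suc i , n ⟩) (≡.trans (snd≡ q) r)) , h′)
      to (inj₂ (inj₂ (k , n , p , inj₂ (_ , _ , q , _) , h))) = ⊥-elim (ℕ.0≢1+n (fst≡ q))

      from : sequence (As ∷ʳ A) ⊆ snoc (sequence As) A
      from (inj₁ p) = inj₁ (length As , ≡.trans p (cong ⟨ 0 ,_⟩ length-∷ʳ) , inj₁ refl)
      from (inj₂ (i , n , p , h)) with lookup-∷ʳ⁻ As i h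
      ... | inj₁ (j , q , h′) =
        inj₂ (inj₁ (toℕ i , n , p , inj₂ (j , n , cong (λ i → ⟨ suc i , n ⟩) q , h′)))
      ... | inj₂ (q , h′) =
        inj₂ (inj₂ (toℕ i , n , p , inj₁ (cong ⟨ 0 ,_⟩ q) , h′))

graphModel : (ℕ × ℕ) ↔ ℕ → ApplicativeStructure (lsuc 0ℓ) 0ℓ 0ℓ
graphModel = GraphModel.structure

{-# OPTIONS --safe #-}
-- The sets {B | n ∈ B} are open, so continuity gives open sets Wₙ such that
-- n ∈ f(A) iff A ∈ Wₙ, for A in the domain of f. Membership in Wₙ amounts to
-- p ⊆ A and q ⊆ C(A) for some basic open set U_p^q ⊆ Wₙ. Hence f(A) = H(A, C(A))
-- on the domain, where H is Scott continuous in both arguments, and f is computed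
-- by asking for the complement of the input once.
module Submission where

open import Level using (0ℓ; Lift; lift) renaming (suc to lsuc)
open import Data.Fin using (zero; suc)
open import Data.List using ([]; _∷_; length)
open import Data.List.Relation.Unary.Any using (here)
open import Data.Nat using (ℕ; suc)
open import Data.Product using (∃₂; _×_; _,_; proj₁; proj₂)
open import Function using (_↔_; _⇔_; Equivalence)
open import Axiom.ExcludedMiddle using (ExcludedMiddle)
open import Relation.Binary.Bundles using (Setoid)
open import Relation.Binary.PropositionalEquality using (_≡_; refl; subst)
open import Relation.Nullary.Decidable using (True; toWitness; fromWitness)
open import Relation.Unary using (Pred; _∈_; _⊆_; _≐_; ∁)
open import Defs

private module S = Setoid 𝒫ℕ-setoid

module _ (π : (ℕ × ℕ) ↔ ℕ) where
  open GraphModel π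
  open ApplicativeStructure structure using (_·_·_↓_; _·_·_·_↓_)

  ∙-congˡ : ∀ A {B B′} → B ≐ B′ → A ∙ B ≐ A ∙ B′
  ∙-congˡ A = ∙-cong (S.refl {A})

  ∙-congʳ : ∀ {A A′} B → A ≐ A′ → A ∙ B ≐ A′ ∙ B
  ∙-congʳ B eq = ∙-cong eq (S.refl {B})

  ∙²-≐ : ∀ A B C {D} → A · B · C ↓ D → A ∙ B ∙ C ≐ D
  ∙²-≐ A B C (_ , h , h′) = S.trans (∙-congʳ C h) h′

  ∙³-≐ : ∀ A B C D {E} → A · B · C · D ↓ E → A ∙ B ∙ C ∙ D ≐ E
  ∙³-≐ A B C D (AB , h , h′) = S.trans (∙-congʳ D (∙-congʳ C h)) (∙²-≐ AB C D h′)

  module _ (κ : Coding structure) (K : 𝒫ℕ) where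
    open Coding κ

    -- isQuestion detects length 1, when the input has not yet been followed by a reply.
    input reply isQuestion ask answer step : 𝒫ℕ → 𝒫ℕ
    input X      = projection ∙ numeral 0 ∙ X
    reply X      = projection ∙ numeral 1 ∙ X
    isQuestion X = isZero ∙ (predecessor ∙ (seqLength ∙ X))
    ask X        = pairing ∙ F ∙ input X
    answer X     = pairing ∙ T ∙ (K ∙ input X ∙ reply X)
    step X       = D ∙ isQuestion X ∙ ask X ∙ answer X

    -- Lets `abs-∙` turn application of `abs step` into `step` itself.
    step-continuous : ScottContinuous step
    step-continuous =
      ∙-continuous (∙-continuous (const∙ D isQuestion-continuous) (const∙ (pairing ∙ F) input-continuous))
        (const∙ (pairing ∙ T) (∙-continuous (const∙ K input-continuous) reply-continuous))
      where
      const∙ : ∀ A {G} → ScottContinuous G → ScottContinuous (λ X → A ∙ G X)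
      const∙ A = ∙-continuous (const-continuous A)
      const∙id : ∀ A → ScottContinuous (A ∙_)
      const∙id A = const∙ A id-continuous
      input-continuous : ScottContinuous input
      input-continuous = const∙id (projection ∙ numeral 0)
      reply-continuous : ScottContinuous reply
      reply-continuous = const∙id (projection ∙ numeral 1)
      isQuestion-continuous : ScottContinuous isQuestion
      isQuestion-continuous = const∙ isZero (const∙ predecessor (const∙id seqLength))

    -- `predecessor` is specified only at successors, hence the length in the form `suc n`.
    isQuestion-≐ : ∀ As {n B} → length As ≡ suc n → isZero ∙ numeral n ≐ B →
                   isQuestion (sequence As) ≐ B
    isQuestion-≐ As {n} eq h = S.trans
      (∙-congˡ isZero (S.trans
        (∙-congˡ predecessor (subst (λ m → seqLength ∙ sequence As ≐ numeral m) eq (length-law As)))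
        (predecessor-law n)))
      h

    -- Here `reply X` projects past the end and is unspecified, but application is total, so
    -- `answer X` is still some set and `D` discards it.
    step-ask : ∀ A → step (sequence (A ∷ [])) ≐ pair F A
    step-ask A = S.trans
      (∙-congʳ (answer X) (∙-congʳ (ask X) (∙-congˡ D (isQuestion-≐ (A ∷ []) refl isZero-zero))))
      (S.trans (∙³-≐ D T _ _ (D-T (ask X) (answer X)))
        (S.trans (∙-congˡ (pairing ∙ F) (∙²-≐ projection _ _ (projection-law _ zero)))
          (∙²-≐ pairing F A (pairing-law F A))))
      where X = sequence (A ∷ [])

    step-answer : ∀ A B {C} → K ∙ A ∙ B ≐ C → step (sequence (A ∷ B ∷ [])) ≐ pair T C
    step-answer A B {C} eq = S.trans
      (∙-congʳ (answer X) (∙-congʳ (ask X) (∙-congˡ D (isQuestion-≐ (A ∷ B ∷ []) refl (isZero-suc 0)))))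
      (S.trans (∙³-≐ D F _ _ (D-F (ask X) (answer X)))
        (S.trans (∙-congˡ (pairing ∙ T) (S.trans (∙-cong (∙-congˡ K input-≐) reply-≐) eq))
          (∙²-≐ pairing T C (pairing-law T C))))
      where
      X = sequence (A ∷ B ∷ [])
      input-≐ : input X ≐ A
      input-≐ = ∙²-≐ projection _ _ (projection-law _ zero)
      reply-≐ : reply X ≐ B
      reply-≐ = ∙²-≐ projection _ _ (projection-law _ (suc zero))

    query-complement : ∀ {A B} → K ∙ A ∙ ∁ A ≐ B →
                       Relative.Computation structure κ complement (abs step) A B
    query-complement {A} eq = record
      { n       = 1
      ; query   = λ _ → A
      ; answer  = λ _ → ∁ A
      ; answers = λ _ → S.refl
      -- The only index is `zero`, so no answers precede the query and the sequence holds just the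
      -- input.
      ; asks    = λ { zero → S.trans (abs-∙ step-continuous _) (step-ask A) }
      ; halts   = S.trans (abs-∙ step-continuous _) (step-answer A (∁ A) eq)
      }

-- `Lift` moves the predicate to the level of the carrier, where open sets live.
∋-open : ∀ n → Topology.IsOpen cantor (λ A → Lift (lsuc 0ℓ) (n ∈ A))
∋-open n (lift n∈A) =
  n ∷ [] , [] , (λ ()) , ((λ { (here refl) → n∈A }) , λ _ ()) , λ (⊆B , _) → lift (⊆B (here refl))

-- Avoiding `q` becomes the positive condition `e k ⊆ ∁ A`, which is Scott open in the complement.
open⇒codes : ∀ {V A} → Topology.IsOpen cantor V → A ∈ V →
             ∃₂ λ m k → (e m ⊆ A × e k ⊆ ∁ A) × (∀ B → e m ⊆ B → e k ⊆ ∁ B → B ∈ V)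
open⇒codes V-open A∈V =
  let p , q , _ , (p⊆A , A∩q) , U⊆V = V-open A∈V
      m , em⊆p , p⊆em = e-surjective p
      k , ek⊆q , q⊆ek = e-surjective q
  in m , k , ((λ i → p⊆A (em⊆p i)) , λ i a → A∩q _ (a , ek⊆q i)) ,
     λ _ em⊆B ek⊆∁B → U⊆V ((λ i → em⊆B (p⊆em i)) , λ _ (b , i) → ek⊆∁B (q⊆ek i) b)

lemma2p5 : ExcludedMiddle (lsuc 0ℓ) →
    (π : (ℕ × ℕ) ↔ ℕ) (κ : Coding (graphModel π)) →
    IsConrep (graphModel π [ κ , complement ]) cantor
lemma2p5 em π κ f f-continuous =
  -- The representing element is `abs step` for the `K` below.
  _ , λ {A} fA≡B → query-complement π κ K
    (S.trans (∙²-≐ π K A (∁ A) (abs₂-law H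
        (λ _ n → ∃-open λ m → ∃-open λ k → ×-open const-open (×-open (e⊆-open m id-continuous) const-open))
        (λ _ n → ∃-open λ m → ∃-open λ k → ×-open const-open (×-open const-open (e⊆-open k id-continuous)))
        A (∁ A) S.refl))
      (H-value fA≡B))
  where
  open GraphModel π
  open PartialFunction f

  W : ℕ → Pred 𝒫ℕ (lsuc 0ℓ)
  W n = proj₁ (f-continuous _ (∋-open n))

  -- Quantification over 𝒫ℕ leaves Set; excluded middle brings it back.
  BasicIn : ℕ → ℕ → ℕ → Set
  BasicIn n m k = True (em {∀ B → e m ⊆ B → e k ⊆ ∁ B → B ∈ W n})

  -- `A′` is kept independent of `A`: `H` is monotone in each argument, while `H A (∁ A)` need not
  -- be monotone in `A`.
  H : 𝒫ℕ → 𝒫ℕ → 𝒫ℕ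
  H A A′ n = ∃₂ λ m k → BasicIn n m k × e m ⊆ A × e k ⊆ A′

  K : 𝒫ℕ
  K = abs (λ A → abs (H A))

  -- A pair of codes counted by `H` gives a basic open set around `A` inside `W n`; conversely,
  -- openness of `W n` supplies one. As `A` is in the domain, `A ∈ W n` then amounts to `n ∈ B`.
  H-value : ∀ {A B} → Graph A B → H A (∁ A) ≐ B
  H-value {A} {B} fA≡B =
    (λ {n} (_ , _ , U⊆W , m⊆A , k⊆∁A) →
      let lift n∈B = Equivalence.to (W⇔ n) (toWitness U⊆W A m⊆A k⊆∁A) in n∈B) ,
    λ {n} n∈B →
      let m , k , (m⊆A , k⊆∁A) , U⊆W = open⇒codes (W-open n) (Equivalence.from (W⇔ n) (lift n∈B))
      in m , k , fromWitness U⊆W , m⊆A , k⊆∁A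
    where
    W-open : ∀ n → Topology.IsOpen cantor (W n)
    W-open n = proj₁ (proj₂ (f-continuous _ (∋-open n)))
    W⇔ : ∀ n → A ∈ W n ⇔ Lift (lsuc 0ℓ) (n ∈ B)
    W⇔ n = proj₂ (proj₂ (f-continuous _ (∋-open n))) fA≡B
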